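{- There is a function $h$ such that for every integer $t\geq 2$ and real $\varepsilon>0$, every graph $G$ with average degree at least $2^t+\varepsilon$ contains a $K_t$-model with at most $h(t,\varepsilon)\cdot\log|G|$ vertices.
   Context: Graphs are finite, simple and undirected; $|G|$ is the number of vertices; the average degree is $2|E(G)|/|V(G)|$. A $K_t$-model in $G$ consists of $t$ pairwise vertex-disjoint connected subgraphs $B_1,\dots,B_t$ (branch sets) such that for all distinct $i,j$ some vertex of $B_i$ is adjacent to some vertex of $B_j$; its number of vertices is $\sum_i|B_i|$. Logarithms are binary. -}

module Defs where

open import Data.Nat using (ℕ; NonZero)
open import Data.Fin using (Fin)
open import Data.Bool using (Bool; true; false; if_then_else_)
open import Data.Maybe using (Maybe; just; nothing; is-just)
open import Data.List using (List; map; allFin)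
open import Data.Nat.ListAction using (sum)
open import Data.Integer using (+_)
open import Data.Rational using (ℚ; _/_)
open import Data.Product using (Σ; ∃; ∃₂; _×_)
open import Relation.Binary.PropositionalEquality using (_≡_; _≢_)

record Graph (n : ℕ) : Set where
  field
    adj   : Fin n → Fin n → Bool
    sym   : ∀ u v → adj u v ≡ adj v u
    irrefl : ∀ v → adj v v ≡ false
open Graph public

sumV : {n : ℕ} → (Fin n → ℕ) → ℕ
sumV {n} f = sum (map f (allFin n))

degree : {n : ℕ} → Graph n → Fin n → ℕ
degree G u = sumV (λ v → if adj G u v then 1 else 0)

twiceEdges : {n : ℕ} → Graph n → ℕ
twiceEdges G = sumV (degree G)

averageDegree : {n : ℕ} → .{{_ : NonZero n}} → Graph n → ℚ
averageDegree {n} G = (+ twiceEdges G) / n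

data PathIn {n : ℕ} (G : Graph n) (P : Fin n → Set) : Fin n → Fin n → Set where
  here : ∀ {u} → P u → PathIn G P u u
  step : ∀ {u w v} → P u → adj G u w ≡ true → PathIn G P w v → PathIn G P u v

-- A K_t-model: branch v = just i means v ∈ B_i, nothing means v is in no branch set
-- (so branch sets are automatically pairwise vertex-disjoint).
record KModel {n : ℕ} (G : Graph n) (t : ℕ) : Set where
  field
    branch    : Fin n → Maybe (Fin t)
    nonempty  : ∀ i → ∃ λ v → branch v ≡ just i
    connected : ∀ i u v → branch u ≡ just i → branch v ≡ just i →
                PathIn G (λ w → branch w ≡ just i) u v
    touching  : ∀ i j → i ≢ j →
                ∃₂ λ u v → branch u ≡ just i × branch v ≡ just j × adj G u v ≡ true
open KModel public

modelSize : {n t : ℕ} {G : Graph n} → KModel G t → ℕ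
modelSize M = sumV (λ v → if is-just (branch M v) then 1 else 0)

{-# OPTIONS --safe #-}

-- Let g = 2^(t-1) − 4.  A vertex set U spanning more than (g + 2)|U| edges is explored from a
-- root by growing a connected core X, the frontier F being its neighbourhood in U, through
-- absorption of frontier vertices with at most g neighbours in F.  The edges meeting X then
-- number at most g|X| + |X ∪ F|.  A round absorbs as many vertices of its initial frontier as
-- possible, so after i rounds X has radius at most i.  At the end of a round:
--   * if F has average degree > g, it contains a small K_{t-1}-model, and paths in X from the
--     root to each of its branch sets form one further branch set;
--   * if |F| ≤ |X|, then deleting X keeps U dense, and one starts again in U \ X;
--   * otherwise the vertices left over from the initial frontier, having more than g neighbours
--     in F, make up at most a fraction g/(g + 1) of F, so |X ∪ F| has grown by a factor of at
--     least 1 + 1/(2g + 2).  This can happen O(log n) times only.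
module Submission where

open import Defs hiding (sym)
open import Data.Nat using (ℕ; NonZero; _≤_; _^_)
open import Data.Product using (Σ)

open import Data.Bool using (Bool; true; false; _∧_; _∨_; if_then_else_)
open import Data.Bool.Properties using (∨-zeroʳ)
open import Data.Fin using (Fin; zero; suc)
import Data.Fin.Properties as Fin
import Data.Integer as ℤ
import Data.Integer.Properties as ℤ
open import Data.List.Properties using (map-tabulate)
open import Data.Maybe using (Maybe; just; nothing; is-just)
import Data.Maybe as Maybe
open import Data.Nat using (zero; suc; _*_; _∸_; _<_; z≤n; s≤s; s≤s⁻¹; _≤?_; _<?_; >-nonZero⁻¹)
open import Data.Nat.ListAction using (sum)
open import Data.Nat.Properties hiding (_≟_)
open import Data.Nat.Tactic.RingSolver using (solve-∀)
open import Data.Product using (∃; ∃₂; _×_; _,_; proj₁; proj₂)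
import Data.Rational.Properties as ℚ
import Data.Rational.Unnormalised as ℚᵘ
import Data.Rational.Unnormalised.Properties as ℚᵘ
open import Data.Sum using (_⊎_; inj₁; inj₂)
open import Function using (_∘_; const)
open import Relation.Binary.PropositionalEquality using (_≡_; _≢_; refl; sym; trans; cong; cong₂; subst; subst₂; module ≡-Reasoning)
open import Relation.Nullary using (¬_; Dec; yes; no; does; contradiction; _×-dec_)

-- Indicators, finite sums over vertices and cardinalities.

⟦_⟧ : Bool → ℕ
⟦ b ⟧ = if b then 1 else 0

≟-refl : ∀ {n} (v : Fin n) → does (v Fin.≟ v) ≡ true
≟-refl v with v Fin.≟ v
... | yes _ = refl
... | no v≢v = contradiction refl v≢v

≟-true : ∀ {n} {v w : Fin n} → does (v Fin.≟ w) ≡ true → v ≡ w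
≟-true {v = v} {w} eq with v Fin.≟ w
... | yes v≡w = v≡w

module _ where
  open import Data.Nat using (_+_)

  sumV-suc : ∀ {n} (f : Fin (suc n) → ℕ) → sumV f ≡ f zero + sumV (f ∘ suc)
  sumV-suc {n} f = cong (λ xs → f zero + sum xs)
    (trans (map-tabulate suc f) (sym (map-tabulate (λ i → i) (f ∘ suc))))

  sumV-mono : ∀ {n} {f g : Fin n → ℕ} → (∀ i → f i ≤ g i) → sumV f ≤ sumV g
  sumV-mono {zero} _ = z≤n
  sumV-mono {suc n} {f} {g} f≤g rewrite sumV-suc f | sumV-suc g =
    +-mono-≤ (f≤g zero) (sumV-mono (f≤g ∘ suc))

  sumV-cong : ∀ {n} {f g : Fin n → ℕ} → (∀ i → f i ≡ g i) → sumV f ≡ sumV g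
  sumV-cong f≡g = ≤-antisym (sumV-mono (≤-reflexive ∘ f≡g)) (sumV-mono (≤-reflexive ∘ sym ∘ f≡g))

  sumV-+ : ∀ {n} (f g : Fin n → ℕ) → sumV (λ i → f i + g i) ≡ sumV f + sumV g
  sumV-+ {zero} f g = refl
  sumV-+ {suc n} f g
    rewrite sumV-suc (λ i → f i + g i) | sumV-suc f | sumV-suc g | sumV-+ (f ∘ suc) (g ∘ suc) =
    interchange (f zero) (g zero) _ _
    where
    interchange : ∀ a b c d → a + b + (c + d) ≡ a + c + (b + d)
    interchange = solve-∀

  sumV-* : ∀ {n} k (f : Fin n → ℕ) → sumV (λ i → k * f i) ≡ k * sumV f
  sumV-* {zero} k f = sym (*-zeroʳ k)
  sumV-* {suc n} k f rewrite sumV-suc (λ i → k * f i) | sumV-suc f | sumV-* k (f ∘ suc) =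
    sym (*-distribˡ-+ k (f zero) _)

  sumV-zero : ∀ {n} → sumV {n} (const 0) ≡ 0
  sumV-zero {n} = sumV-* {n} 0 (const 0)

  sumV-one : ∀ {n} → sumV {n} (const 1) ≡ n
  sumV-one {zero} = refl
  sumV-one {suc n} = trans (sumV-suc {n} (const 1)) (cong suc sumV-one)

  sumV-point : ∀ {n} (v : Fin n) (f : Fin n → ℕ) → sumV (λ w → ⟦ does (v Fin.≟ w) ⟧ * f w) ≡ f v
  sumV-point {suc n} zero f
    rewrite sumV-suc (λ w → ⟦ does (zero Fin.≟ w) ⟧ * f w) | sumV-zero {n} =
    trans (+-identityʳ _) (+-identityʳ _)
  sumV-point {suc n} (suc v) f rewrite sumV-suc (λ w → ⟦ does (suc v Fin.≟ w) ⟧ * f w) =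
    sumV-point v (f ∘ suc)

  sumV-positive : ∀ {n} (f : Fin n → ℕ) → 0 < sumV f → ∃ λ i → 0 < f i
  sumV-positive {suc n} f 0<S with 0 <? f zero
  ... | yes 0<f₀ = zero , 0<f₀
  ... | no f₀≯0 with sumV-positive (f ∘ suc)
                      (≤-trans 0<S (≤-trans (≤-reflexive (sumV-suc f)) (+-monoˡ-≤ _ (≮⇒≥ f₀≯0))))
  ...   | i , 0<fi = suc i , 0<fi

  # : ∀ {n} → (Fin n → Bool) → ℕ
  # P = sumV (λ v → ⟦ P v ⟧)

  ⟦⟧≤1 : ∀ b → ⟦ b ⟧ ≤ 1
  ⟦⟧≤1 true = ≤-refl
  ⟦⟧≤1 false = z≤n

  #≤n : ∀ {n} (P : Fin n → Bool) → # P ≤ n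
  #≤n P = ≤-trans (sumV-mono (⟦⟧≤1 ∘ P)) (≤-reflexive sumV-one)

  #-point : ∀ {n} (v : Fin n) → # (λ w → does (v Fin.≟ w)) ≡ 1
  #-point v = trans (sumV-cong {g = λ w → ⟦ does (v Fin.≟ w) ⟧ * 1} (λ w → sym (*-identityʳ _))) (sumV-point v (const 1))

  #-∨ : ∀ {n} (P Q : Fin n → Bool) → # (λ v → P v ∨ Q v) ≤ # P + # Q
  #-∨ P Q = ≤-trans (sumV-mono (λ v → lemma (P v) (Q v))) (≤-reflexive (sumV-+ (⟦_⟧ ∘ P) (⟦_⟧ ∘ Q)))
    where
    lemma : ∀ b c → ⟦ b ∨ c ⟧ ≤ ⟦ b ⟧ + ⟦ c ⟧
    lemma true c = s≤s z≤n
    lemma false c = ≤-refl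

  ∨-introˡ : ∀ {b} c → b ≡ true → b ∨ c ≡ true
  ∨-introˡ c refl = refl

  ∨-introʳ : ∀ b {c} → c ≡ true → b ∨ c ≡ true
  ∨-introʳ b refl = ∨-zeroʳ b

  ∨-elim : ∀ b {c} → b ∨ c ≡ true → b ≡ true ⊎ c ≡ true
  ∨-elim true _ = inj₁ refl
  ∨-elim false eq = inj₂ eq

  true≢false : ∀ {b} → b ≡ true → ¬ b ≡ false
  true≢false refl ()

  ⟦⟧-positive : ∀ b {m} → 0 < ⟦ b ⟧ * m → b ≡ true × 0 < m
  ⟦⟧-positive true {m} 0<m = refl , subst (0 <_) (+-identityʳ m) 0<m

-- Vertex colours during the exploration.

data Colour : Set where
  outside core frontier unseen : Colour

-- `core` is the set X, `frontier` is F, `unseen` is what remains of `U`, and `outside` is the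
-- complement of `U`. Thus `isRest` describes `U` without X, and `isSeen` describes the union of X
-- and F.
isInside isCore isFrontier isUnseen isRest isSeen : Colour → Bool
isInside outside = false
isInside _ = true
isCore core = true
isCore _ = false
isFrontier frontier = true
isFrontier _ = false
isUnseen unseen = true
isUnseen _ = false
isRest frontier = true
isRest unseen = true
isRest _ = false
isSeen core = true
isSeen frontier = true
isSeen _ = false

isFrontier? : ∀ x → Dec (x ≡ frontier)
isFrontier? outside = no λ ()
isFrontier? core = no λ ()
isFrontier? frontier = yes refl
isFrontier? unseen = no λ ()

promote : Colour → Colour
promote unseen = frontier
promote x = x

-- The first flag says that the vertex is the one being absorbed, the second that it is adjacent to
-- the absorbed one.
advance : Bool → Bool → Colour → Colour
advance true _ _ = core
advance false true x = promote x
advance false false x = x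

-- The changes of colour possible over one whole round. There is no passage from `unseen` to `core`:
-- a vertex discovered in a round waits for a later one, which keeps the radius under control.
data _↝_ : Colour → Colour → Set where
  stay       : ∀ {x} → x ↝ x
  discovered : unseen ↝ frontier
  absorbed   : frontier ↝ core

↝-promote : ∀ {x y} → x ↝ y → x ↝ promote y
↝-promote {outside} stay = stay
↝-promote {core} stay = stay
↝-promote {frontier} stay = stay
↝-promote {unseen} stay = discovered
↝-promote discovered = discovered
↝-promote absorbed = absorbed

core-↝ : ∀ {x y} → x ↝ y → x ≡ core → y ≡ core
core-↝ stay eq = eq
core-↝ discovered ()
core-↝ absorbed ()

↝-core : ∀ {x y} → x ↝ y → y ≡ core → x ≡ core ⊎ x ≡ frontier
↝-core stay eq = inj₁ eq
↝-core discovered ()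
↝-core absorbed _ = inj₂ refl

remained appeared : Colour → Colour → Bool
remained x y = isFrontier x ∧ isFrontier y
appeared x y = isUnseen x ∧ isFrontier y

-- The colouring before the root is absorbed; b says whether the vertex is the root.
initial : (inside b : Bool) → Colour
initial false _ = outside
initial true b = if b then frontier else unseen

-- Effect of a colour change on the counts.

module _ where
  open import Data.Nat using (_+_)

  advance-core : ∀ b a {x} → (b ≡ true → x ≡ frontier) → ⟦ isCore (advance b a x) ⟧ ≡ ⟦ isCore x ⟧ + ⟦ b ⟧
  advance-core true a hit rewrite hit refl = refl
  advance-core false true {outside} _ = refl
  advance-core false true {core} _ = refl
  advance-core false true {frontier} _ = refl
  advance-core false true {unseen} _ = refl
  advance-core false false _ = sym (+-identityʳ _)

  advance-rest : ∀ b a {x} → (b ≡ true → x ≡ frontier) → ⟦ isRest x ⟧ ≡ ⟦ isRest (advance b a x) ⟧ + ⟦ b ⟧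
  advance-rest true a hit rewrite hit refl = refl
  advance-rest false true {outside} _ = refl
  advance-rest false true {core} _ = refl
  advance-rest false true {frontier} _ = refl
  advance-rest false true {unseen} _ = refl
  advance-rest false false _ = sym (+-identityʳ _)

  advance-seen : ∀ b a {x} → (b ≡ true → x ≡ frontier) →
                 ⟦ isSeen (advance b a x) ⟧ ≡ ⟦ isSeen x ⟧ + ⟦ isUnseen x ⟧ * ⟦ a ⟧
  advance-seen true a hit rewrite hit refl = refl
  advance-seen false true {outside} _ = refl
  advance-seen false true {core} _ = refl
  advance-seen false true {frontier} _ = refl
  advance-seen false true {unseen} _ = refl
  advance-seen false false {outside} _ = refl
  advance-seen false false {core} _ = refl
  advance-seen false false {frontier} _ = refl
  advance-seen false false {unseen} _ = refl

  advance-inside : ∀ b a {x} → (b ≡ true → x ≡ frontier) → isInside (advance b a x) ≡ isInside x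
  advance-inside true a hit rewrite hit refl = refl
  advance-inside false true {outside} _ = refl
  advance-inside false true {core} _ = refl
  advance-inside false true {frontier} _ = refl
  advance-inside false true {unseen} _ = refl
  advance-inside false false _ = refl

  rest-split : ∀ x → ⟦ isRest x ⟧ ≡ ⟦ isFrontier x ⟧ + ⟦ isUnseen x ⟧
  rest-split outside = refl
  rest-split core = refl
  rest-split frontier = refl
  rest-split unseen = refl

  seen-split : ∀ x → ⟦ isSeen x ⟧ ≡ ⟦ isCore x ⟧ + ⟦ isFrontier x ⟧
  seen-split outside = refl
  seen-split core = refl
  seen-split frontier = refl
  seen-split unseen = refl

  inside-split : ∀ x → ⟦ isInside x ⟧ ≡ ⟦ isCore x ⟧ + ⟦ isRest x ⟧
  inside-split outside = refl
  inside-split core = refl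
  inside-split frontier = refl
  inside-split unseen = refl

  frontier-split : ∀ {x y} → x ↝ y → ⟦ isFrontier y ⟧ ≡ ⟦ remained x y ⟧ + ⟦ appeared x y ⟧
  frontier-split {outside} stay = refl
  frontier-split {core} stay = refl
  frontier-split {frontier} stay = refl
  frontier-split {unseen} stay = refl
  frontier-split discovered = refl
  frontier-split absorbed = refl

  seen-↝ : ∀ {x y} → x ↝ y → ⟦ isSeen x ⟧ + ⟦ appeared x y ⟧ ≤ ⟦ isSeen y ⟧
  seen-↝ {outside} stay = ≤-refl
  seen-↝ {core} stay = ≤-refl
  seen-↝ {frontier} stay = ≤-refl
  seen-↝ {unseen} stay = ≤-refl
  seen-↝ discovered = ≤-refl
  seen-↝ absorbed = ≤-refl

  -- Bernoulli's inequality, exponential growth and the constants of the induction.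

  bernoulli : ∀ q m → q ^ m * (q + m) ≤ q * suc q ^ m
  bernoulli q zero = ≤-reflexive (base q)
    where
    base : ∀ q → 1 * (q + 0) ≡ q * 1
    base = solve-∀
  bernoulli q (suc m) = begin
    q * q ^ m * (q + suc m)                 ≤⟨ m≤m+n _ (q ^ m * m) ⟩
    q * q ^ m * (q + suc m) + q ^ m * m     ≡⟨ expand q m (q ^ m) ⟩
    suc q * (q ^ m * (q + m))               ≤⟨ *-monoʳ-≤ (suc q) (bernoulli q m) ⟩
    suc q * (q * suc q ^ m)                 ≡⟨ swap (suc q) q (suc q ^ m) ⟩
    q * (suc q * suc q ^ m)                 ∎
    where
    open ≤-Reasoning
    expand : ∀ q m p → q * p * (q + suc m) + p * m ≡ suc q * (p * (q + m))
    expand = solve-∀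
    swap : ∀ a b c → a * (b * c) ≡ b * (a * c)
    swap = solve-∀

  -- Bernoulli's inequality at `m = q`, that is, (1 + 1/q)^q is at least 2, with denominators
  -- cleared.
  double-power : ∀ q .{{_ : NonZero q}} → q ^ q * 2 ≤ suc q ^ q
  double-power q = *-cancelˡ-≤ q (≤-trans (≤-reflexive (regroup q (q ^ q))) (bernoulli q q))
    where
    regroup : ∀ q p → q * (p * 2) ≡ p * (q + q)
    regroup = solve-∀

  ^-distribʳ-* : ∀ k a b → (a * b) ^ k ≡ a ^ k * b ^ k
  ^-distribʳ-* zero a b = refl
  ^-distribʳ-* (suc k) a b rewrite ^-distribʳ-* k a b = regroup a b (a ^ k) (b ^ k)
    where
    regroup : ∀ a b c d → a * b * (c * d) ≡ a * c * (b * d)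
    regroup = solve-∀

  -- A quantity that starts at 1 or more and grows by a factor 1 + 1/q in each of `q * L` rounds
  -- reaches `2 ^ L`.
  exponential-growth : ∀ q .{{_ : NonZero q}} L → q ^ (q * L) * 2 ^ L ≤ suc q ^ (q * L)
  exponential-growth q L = begin
    q ^ (q * L) * 2 ^ L   ≡⟨ cong (_* 2 ^ L) (^-*-assoc q q L) ⟨
    (q ^ q) ^ L * 2 ^ L   ≡⟨ ^-distribʳ-* L (q ^ q) 2 ⟨
    (q ^ q * 2) ^ L       ≤⟨ ^-monoˡ-≤ L (double-power q) ⟩
    (suc q ^ q) ^ L       ≡⟨ ^-*-assoc (suc q) q L ⟩
    suc q ^ (q * L)       ∎
    where open ≤-Reasoning

  -- The average degree above which a small model of the complete graph on `2 + t` vertices is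
  -- found. The recursion is solved by `2 ^ (2 + t)` minus 4.
  threshold : ℕ → ℕ
  threshold zero = 0
  threshold (suc t) = 2 * threshold t + 4

  -- Size of the model of order `2 + t` in units of `L`. The increment pays for a new branch set: 1
  -- for the root, and `2 + t` connections to it of at most `suc q * L` vertices each, where
  -- `q = 2 * suc (threshold t)`.
  cost : ℕ → ℕ
  cost zero = 2
  cost (suc t) = cost t + (1 + (2 + t) * suc (2 * suc (threshold t)))

-- Paths, rooted connected sets and models inside a vertex set.

module _ {n : ℕ} (G : Graph n) where
  open import Data.Nat using (_+_)

  PathIn-mono : ∀ {P Q : Fin n → Set} → (∀ w → P w → Q w) → ∀ {u v} → PathIn G P u v → PathIn G Q u v
  PathIn-mono P⊆Q (here p) = here (P⊆Q _ p)
  PathIn-mono P⊆Q (step p e π) = step (P⊆Q _ p) e (PathIn-mono P⊆Q π)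

  PathIn-trans : ∀ {P : Fin n → Set} {u v w} → PathIn G P u v → PathIn G P v w → PathIn G P u w
  PathIn-trans (here _) ρ = ρ
  PathIn-trans (step p e π) ρ = step p e (PathIn-trans π ρ)

  PathIn-start : ∀ {P : Fin n → Set} {u v} → PathIn G P u v → P u
  PathIn-start (here p) = p
  PathIn-start (step p _ _) = p

  PathIn-sym : ∀ {P : Fin n → Set} {u v} → PathIn G P u v → PathIn G P v u
  PathIn-sym (here p) = here p
  PathIn-sym (step {u} {w} p e π) =
    PathIn-trans (PathIn-sym π) (step (PathIn-start π) (trans (Graph.sym G w u) e) (here p))

  -- Connectedness is expressed by paths to a fixed root, so that sets with the same root can be
  -- united without further argument.
  record Rooted (r : Fin n) (P : Fin n → Bool) : Set where
    field
      root : P r ≡ true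
      path : ∀ x → P x ≡ true → PathIn G (λ w → P w ≡ true) x r
  open Rooted

  rooted-point : ∀ r → Rooted r (λ w → does (r Fin.≟ w))
  rooted-point r .root = ≟-refl r
  rooted-point r .path x eq with ≟-true {v = r} {x} eq
  ... | refl = here (≟-refl r)

  rooted-∨ : ∀ {r P Q} → Rooted r P → Rooted r Q → Rooted r (λ w → P w ∨ Q w)
  rooted-∨ {Q = Q} p q .root = ∨-introˡ (Q _) (p .root)
  rooted-∨ {P = P} {Q} p q .path x eq with ∨-elim (P x) eq
  ... | inj₁ Px = PathIn-mono (λ w → ∨-introˡ (Q w)) (p .path x Px)
  ... | inj₂ Qx = PathIn-mono (λ w → ∨-introʳ (P w)) (q .path x Qx)

  rooted-extend : ∀ {r P x v} → Rooted r P → P x ≡ true → adj G x v ≡ true →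
                  Rooted r (λ w → does (v Fin.≟ w) ∨ P w)
  rooted-extend {v = v} p Px xv .root = ∨-introʳ (does (v Fin.≟ _)) (p .root)
  rooted-extend {P = P} {x} {v} p Px xv .path y eq with ∨-elim (does (v Fin.≟ y)) eq
  ... | inj₂ Py = PathIn-mono (λ w → ∨-introʳ (does (v Fin.≟ w))) (p .path y Py)
  ... | inj₁ v≡y with ≟-true {v = v} {y} v≡y
  ...   | refl = step (∨-introˡ (P v) (≟-refl v)) (trans (Graph.sym G v x) xv)
                   (PathIn-mono (λ w → ∨-introʳ (does (v Fin.≟ w))) (p .path x Px))

  ModelIn : (U : Fin n → Bool) (t s : ℕ) → Set
  ModelIn U t s = Σ (KModel G t) λ M →
    modelSize M ≤ s × (∀ v i → branch M v ≡ just i → U v ≡ true)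

  emptyModel : ∀ U → ModelIn U 0 0
  emptyModel U = M , ≤-reflexive (sumV-zero {n}) , λ v ()
    where
    M : KModel G 0
    M .branch _ = nothing
    M .nonempty ()
    M .connected ()
    M .touching ()

  -- `P` becomes branch set `zero` and the old indices move up by one. The old branch sets lie in
  -- `W`, which `P` avoids, so disjointness is preserved.
  attach : ∀ {U W t s} (P : Fin n → Bool) {r} (M : ModelIn W t s) → Rooted r P →
           (∀ v → P v ≡ true → W v ≡ false) →
           (∀ v → P v ≡ true → U v ≡ true) → (∀ v → W v ≡ true → U v ≡ true) →
           (∀ i → ∃₂ λ u v → P u ≡ true × branch (proj₁ M) v ≡ just i × adj G u v ≡ true) →
           ModelIn U (suc t) (# P + s)
  attach {U} {W} {t} {s} P {r} (M , M≤s , M⊆W) rooted disjoint P⊆U W⊆U touch = M' , size , inside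
    where
    extend : Bool → Maybe (Fin t) → Maybe (Fin (suc t))
    extend b m = if b then just zero else Maybe.map suc m

    branch' : Fin n → Maybe (Fin (suc t))
    branch' v = extend (P v) (branch M v)

    zero⁺ : ∀ v → P v ≡ true → branch' v ≡ just zero
    zero⁺ v Pv rewrite Pv = refl

    zero⁻ : ∀ v → branch' v ≡ just zero → P v ≡ true
    zero⁻ v eq with P v | branch M v
    ... | true | _ = refl
    zero⁻ v () | false | just _
    zero⁻ v () | false | nothing

    suc⁺ : ∀ v i → branch M v ≡ just i → branch' v ≡ just (suc i)
    suc⁺ v i eq with P v in Pv
    ... | true = contradiction (disjoint v Pv) (true≢false (M⊆W v i eq))
    ... | false rewrite eq = refl

    suc⁻ : ∀ v i → branch' v ≡ just (suc i) → branch M v ≡ just i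
    suc⁻ v i eq with P v | branch M v
    suc⁻ v i () | true | _
    suc⁻ v i refl | false | just _ = refl
    suc⁻ v i () | false | nothing

    M' : KModel G (suc t)
    M' .branch = branch'
    M' .nonempty zero = r , zero⁺ r (root rooted)
    M' .nonempty (suc i) with M .nonempty i
    ... | v , eq = v , suc⁺ v i eq
    M' .connected zero u v bu bv = PathIn-mono zero⁺
      (PathIn-trans (path rooted u (zero⁻ u bu)) (PathIn-sym (path rooted v (zero⁻ v bv))))
    M' .connected (suc i) u v bu bv =
      PathIn-mono (λ w → suc⁺ w i) (M .connected i u v (suc⁻ u i bu) (suc⁻ v i bv))
    M' .touching zero zero i≢j = contradiction refl i≢j
    M' .touching zero (suc j) _ with touch j
    ... | u , v , Pu , bv , uv = u , v , zero⁺ u Pu , suc⁺ v j bv , uv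
    M' .touching (suc i) zero _ with touch i
    ... | u , v , Pu , bv , uv = v , u , suc⁺ v i bv , zero⁺ u Pu , trans (Graph.sym G v u) uv
    M' .touching (suc i) (suc j) i≢j with M .touching i j (i≢j ∘ cong suc)
    ... | u , v , bu , bv , uv = u , v , suc⁺ u i bu , suc⁺ v j bv , uv

    extend-size : ∀ b m → ⟦ is-just (extend b m) ⟧ ≤ ⟦ b ⟧ + ⟦ is-just m ⟧
    extend-size true m = s≤s z≤n
    extend-size false (just _) = ≤-refl
    extend-size false nothing = ≤-refl

    size : modelSize M' ≤ # P + s
    size = begin
      modelSize M'       ≤⟨ sumV-mono (λ v → extend-size (P v) (branch M v)) ⟩
      sumV (λ v → ⟦ P v ⟧ + ⟦ is-just (branch M v) ⟧) ≡⟨ sumV-+ (⟦_⟧ ∘ P) (⟦_⟧ ∘ is-just ∘ branch M) ⟩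
      # P + modelSize M  ≤⟨ +-monoʳ-≤ (# P) M≤s ⟩
      # P + s            ∎
      where open ≤-Reasoning

    inside : ∀ v i → branch' v ≡ just i → U v ≡ true
    inside v zero eq = P⊆U v (zero⁻ v eq)
    inside v (suc i) eq = W⊆U v (M⊆W v i (suc⁻ v i eq))

  -- Edges spanned by a vertex set.

  deg : (Fin n → Bool) → Fin n → ℕ
  deg A u = sumV (λ w → ⟦ A w ⟧ * ⟦ adj G u w ⟧)

  -- Twice the number of edges with both ends in A.
  E : (Fin n → Bool) → ℕ
  E A = sumV (λ u → ⟦ A u ⟧ * deg A u)

  -- Each edge at `v` enters `E A` once from each end. The end `v` contributes `deg A v`; the other
  -- ends contribute `deg A' v`, which is no larger.
  E-delete : ∀ {A A' v} → (∀ w → ⟦ A w ⟧ ≡ ⟦ A' w ⟧ + ⟦ does (v Fin.≟ w) ⟧) →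
             E A ≤ E A' + 2 * deg A v
  E-delete {A} {A'} {v} split = begin
    E A
      ≡⟨ sumV-cong {g = λ u → ⟦ A' u ⟧ * deg A' u + ⟦ A' u ⟧ * ⟦ adj G v u ⟧ + δ u * deg A u} pointwise ⟩
    sumV (λ u → ⟦ A' u ⟧ * deg A' u + ⟦ A' u ⟧ * ⟦ adj G v u ⟧ + δ u * deg A u)
      ≡⟨ sumV-+ (λ u → ⟦ A' u ⟧ * deg A' u + ⟦ A' u ⟧ * ⟦ adj G v u ⟧) (λ u → δ u * deg A u) ⟩
    sumV (λ u → ⟦ A' u ⟧ * deg A' u + ⟦ A' u ⟧ * ⟦ adj G v u ⟧) + sumV (λ u → δ u * deg A u)
      ≡⟨ cong₂ _+_ (sumV-+ (λ u → ⟦ A' u ⟧ * deg A' u) (λ u → ⟦ A' u ⟧ * ⟦ adj G v u ⟧))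
                   (sumV-point v (deg A)) ⟩
    E A' + deg A' v + deg A v
      ≤⟨ +-monoˡ-≤ (deg A v) (+-monoʳ-≤ (E A') (≤-trans (m≤m+n _ _) (≤-reflexive (sym (deg-split v))))) ⟩
    E A' + deg A v + deg A v
      ≡⟨ regroup (E A') (deg A v) ⟩
    E A' + 2 * deg A v ∎
    where
    open ≤-Reasoning

    δ : Fin n → ℕ
    δ u = ⟦ does (v Fin.≟ u) ⟧

    deg-split : ∀ u → deg A u ≡ deg A' u + ⟦ adj G u v ⟧
    deg-split u = trans
      (sumV-cong {g = λ w → ⟦ A' w ⟧ * ⟦ adj G u w ⟧ + δ w * ⟦ adj G u w ⟧}
        (λ w → trans (cong (_* ⟦ adj G u w ⟧) (split w)) (*-distribʳ-+ ⟦ adj G u w ⟧ ⟦ A' w ⟧ (δ w))))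
      (trans (sumV-+ (λ w → ⟦ A' w ⟧ * ⟦ adj G u w ⟧) (λ w → δ w * ⟦ adj G u w ⟧))
             (cong (λ m → deg A' u + m) (sumV-point v (λ w → ⟦ adj G u w ⟧))))

    regroup : ∀ e d → e + d + d ≡ e + 2 * d
    regroup = solve-∀

    pointwise : ∀ u → ⟦ A u ⟧ * deg A u ≡ ⟦ A' u ⟧ * deg A' u + ⟦ A' u ⟧ * ⟦ adj G v u ⟧ + δ u * deg A u
    pointwise u = trans
      (cong (_* deg A u) (split u))
      (trans (*-distribʳ-+ (deg A u) ⟦ A' u ⟧ (δ u))
        (cong (_+ δ u * deg A u)
          (trans (cong (⟦ A' u ⟧ *_) (trans (deg-split u) (cong (λ b → deg A' u + ⟦ b ⟧) (Graph.sym G u v))))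
                 (*-distribˡ-+ ⟦ A' u ⟧ (deg A' u) ⟦ adj G v u ⟧))))

  -- Base case of the induction: the two ends of an edge are attached one after the other to the
  -- empty model.
  edge-model : ∀ U → 0 < E U → ModelIn U 2 2
  edge-model U 0<E with sumV-positive (λ u → ⟦ U u ⟧ * deg U u) 0<E
  ... | u , 0<Eu with ⟦⟧-positive (U u) 0<Eu
  ... | Uu , 0<deg with sumV-positive (λ w → ⟦ U w ⟧ * ⟦ adj G u w ⟧) 0<deg
  ... | v , 0<Uv·uv with ⟦⟧-positive (U v) 0<Uv·uv
  ... | Uv , 0<uv = subst (ModelIn U 2) size
        (attach _ K₁ (rooted-point v) disjoint (λ w v≡w → subst (λ x → U x ≡ true) (≟-true v≡w) Uv)
          (λ w u≡w → subst (λ x → U x ≡ true) (≟-true u≡w) Uu)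
          (λ { zero → v , u , ≟-refl v , u∈K₁ , trans (Graph.sym G v u) uv }))
    where
    ⟦⟧-positive⁻ : ∀ b → 0 < ⟦ b ⟧ → b ≡ true
    ⟦⟧-positive⁻ true _ = refl

    uv : adj G u v ≡ true
    uv = ⟦⟧-positive⁻ _ 0<uv

    disjoint : ∀ w → does (v Fin.≟ w) ≡ true → does (u Fin.≟ w) ≡ false
    disjoint w v≡w with u Fin.≟ w
    ... | no _ = refl
    ... | yes refl with ≟-true {v = v} v≡w
    ...   | refl = contradiction (Graph.irrefl G u) (true≢false uv)

    K₁ : ModelIn (λ w → does (u Fin.≟ w)) 1 (# (λ w → does (u Fin.≟ w)) + 0)
    K₁ = attach {W = const false} _ (emptyModel _) (rooted-point u) (λ _ _ → refl) (λ _ e → e) (λ _ ()) (λ ())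

    u∈K₁ : branch (proj₁ K₁) u ≡ just zero
    u∈K₁ rewrite ≟-refl u = refl

    size : # (λ w → does (v Fin.≟ w)) + (# (λ w → does (u Fin.≟ w)) + 0) ≡ 2
    size rewrite #-point v | #-point u = refl

  -- Absorption of frontier vertices and rounds of absorption.

  Colouring : Set
  Colouring = Fin n → Colour

  Attached : Colouring → Fin n → Set
  Attached c v = ∃ λ x → c x ≡ core × adj G x v ≡ true

  absorb : Fin n → Colouring → Colouring
  absorb v c w = advance (does (v Fin.≟ w)) (adj G v w) (c w)

  module _ {c : Colouring} {v : Fin n} (cv : c v ≡ frontier) where

    private
      hit : ∀ w → does (v Fin.≟ w) ≡ true → c w ≡ frontier
      hit w v≡w = subst (λ x → c x ≡ frontier) (≟-true v≡w) cv

    #core-absorb : # (isCore ∘ absorb v c) ≡ # (isCore ∘ c) + 1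
    #core-absorb = begin
      # (isCore ∘ absorb v c)
        ≡⟨ sumV-cong {g = λ w → ⟦ isCore (c w) ⟧ + ⟦ does (v Fin.≟ w) ⟧} (λ w → advance-core _ (adj G v w) (hit w)) ⟩
      sumV (λ w → ⟦ isCore (c w) ⟧ + ⟦ does (v Fin.≟ w) ⟧)
        ≡⟨ sumV-+ (⟦_⟧ ∘ isCore ∘ c) (λ w → ⟦ does (v Fin.≟ w) ⟧) ⟩
      # (isCore ∘ c) + # (λ w → does (v Fin.≟ w))
        ≡⟨ cong (# (isCore ∘ c) +_) (#-point v) ⟩
      # (isCore ∘ c) + 1 ∎
      where open ≡-Reasoning

    rest-absorb : ∀ w → ⟦ isRest (c w) ⟧ ≡ ⟦ isRest (absorb v c w) ⟧ + ⟦ does (v Fin.≟ w) ⟧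
    rest-absorb w = advance-rest _ (adj G v w) (hit w)

    #rest-absorb : # (isRest ∘ c) ≡ # (isRest ∘ absorb v c) + 1
    #rest-absorb = begin
      # (isRest ∘ c)
        ≡⟨ sumV-cong {g = λ w → ⟦ isRest (absorb v c w) ⟧ + ⟦ does (v Fin.≟ w) ⟧} rest-absorb ⟩
      sumV (λ w → ⟦ isRest (absorb v c w) ⟧ + ⟦ does (v Fin.≟ w) ⟧)
        ≡⟨ sumV-+ (⟦_⟧ ∘ isRest ∘ absorb v c) (λ w → ⟦ does (v Fin.≟ w) ⟧) ⟩
      # (isRest ∘ absorb v c) + # (λ w → does (v Fin.≟ w))
        ≡⟨ cong (# (isRest ∘ absorb v c) +_) (#-point v) ⟩
      # (isRest ∘ absorb v c) + 1 ∎
      where open ≡-Reasoning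

    #seen-absorb : # (isSeen ∘ absorb v c) ≡ # (isSeen ∘ c) + deg (isUnseen ∘ c) v
    #seen-absorb = trans
      (sumV-cong {g = λ w → ⟦ isSeen (c w) ⟧ + ⟦ isUnseen (c w) ⟧ * ⟦ adj G v w ⟧}
        (λ w → advance-seen _ (adj G v w) (hit w)))
      (sumV-+ (⟦_⟧ ∘ isSeen ∘ c) (λ w → ⟦ isUnseen (c w) ⟧ * ⟦ adj G v w ⟧))

    inside-absorb : ∀ w → isInside (absorb v c w) ≡ isInside (c w)
    inside-absorb w = advance-inside _ (adj G v w) (hit w)

    core-absorb : ∀ {w} → c w ≡ core → absorb v c w ≡ core
    core-absorb {w} cw with does (v Fin.≟ w) | adj G v w | c w
    core-absorb refl | true | _ | core = refl
    core-absorb refl | false | true | core = refl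
    core-absorb refl | false | false | core = refl

    -- The exception `w ≢ v` serves the very first absorption, when the root lies in the frontier
    -- although the core is still empty.
    attached-absorb : (∀ w → w ≢ v → c w ≡ frontier → Attached c w) →
                      ∀ w → absorb v c w ≡ frontier → Attached (absorb v c) w
    attached-absorb att w eq with v Fin.≟ w | adj G v w in vw | c w in cw
    attached-absorb att w () | yes _ | _ | _
    ... | no v≢w | false | frontier with att w (v≢w ∘ sym) cw
    ...   | x , cx , xw = x , core-absorb cx , xw
    attached-absorb att w eq | no v≢w | true | _ = v , v-core , vw
      where
      v-core : absorb v c v ≡ core
      v-core rewrite ≟-refl v = refl

  absorb-↝ : ∀ {c₀ c : Colouring} {v} → c₀ v ≡ frontier → (∀ w → c₀ w ↝ c w) → ∀ w → c₀ w ↝ absorb v c w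
  absorb-↝ {c₀} {c} {v} c₀v c₀↝c w with v Fin.≟ w
  ... | yes refl = subst (_↝ core) (sym c₀v) absorbed
  ... | no _ with adj G v w
  ...   | true = ↝-promote (c₀↝c w)
  ...   | false = c₀↝c w

  -- The bookkeeping inequality: each absorbed vertex accounts for at most g edges
  -- to the frontier, and every other edge at the core discovers a new vertex.
  record Explored (g : ℕ) (U : Fin n → Bool) (c : Colouring) : Set where
    field
      inside : ∀ v → isInside (c v) ≡ U v
      charge : E U ≤ E (isRest ∘ c) + 2 * (g * # (isCore ∘ c) + # (isSeen ∘ c))
  open Explored

  -- Taking `v` out of the rest loses its edges to the frontier, at most `g` in number, and its
  -- edges to unseen vertices. The former are paid for by the new core vertex, the latter by the
  -- vertices that become seen.
  explored-absorb : ∀ {g U c v} → c v ≡ frontier → deg (isFrontier ∘ c) v ≤ g →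
                    Explored g U c → Explored g U (absorb v c)
  explored-absorb {c = c} cv low ex .inside w = trans (inside-absorb {c} cv w) (ex .inside w)
  explored-absorb {g} {U} {c} {v} cv low ex .charge = begin
    E U
      ≤⟨ ex .charge ⟩
    E (isRest ∘ c) + 2 * (g * X + D)
      ≤⟨ +-monoˡ-≤ _ (E-delete {isRest ∘ c} {isRest ∘ c'} {v} (rest-absorb {c} cv)) ⟩
    Z' + 2 * deg (isRest ∘ c) v + 2 * (g * X + D)
      ≡⟨ cong (λ d → Z' + 2 * d + 2 * (g * X + D)) deg-rest ⟩
    Z' + 2 * (deg (isFrontier ∘ c) v + Y) + 2 * (g * X + D)
      ≤⟨ +-monoˡ-≤ _ (+-monoʳ-≤ Z' (*-monoʳ-≤ 2 (+-monoˡ-≤ Y low))) ⟩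
    Z' + 2 * (g + Y) + 2 * (g * X + D)
      ≡⟨ regroup Z' g X D Y ⟩
    Z' + 2 * (g * (X + 1) + (D + Y))
      ≡⟨ cong₂ (λ x d → Z' + 2 * (g * x + d)) (#core-absorb {c} cv) (#seen-absorb {c} cv) ⟨
    Z' + 2 * (g * # (isCore ∘ c') + # (isSeen ∘ c')) ∎
    where
    open ≤-Reasoning
    c' = absorb v c
    Z' = E (isRest ∘ c')
    X = # (isCore ∘ c)
    D = # (isSeen ∘ c)
    Y = deg (isUnseen ∘ c) v

    deg-rest : deg (isRest ∘ c) v ≡ deg (isFrontier ∘ c) v + Y
    deg-rest = trans
      (sumV-cong {g = λ w → ⟦ isFrontier (c w) ⟧ * ⟦ adj G v w ⟧ + ⟦ isUnseen (c w) ⟧ * ⟦ adj G v w ⟧}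
        (λ w → trans (cong (_* ⟦ adj G v w ⟧) (rest-split (c w)))
                     (*-distribʳ-+ ⟦ adj G v w ⟧ ⟦ isFrontier (c w) ⟧ _)))
      (sumV-+ (λ w → ⟦ isFrontier (c w) ⟧ * ⟦ adj G v w ⟧) (λ w → ⟦ isUnseen (c w) ⟧ * ⟦ adj G v w ⟧))

    regroup : ∀ z g x d y → z + 2 * (g + y) + 2 * (g * x + d) ≡ z + 2 * (g * (x + 1) + (d + y))
    regroup = solve-∀

  -- Only vertices of the frontier of c₀ are absorbed, so that the core's radius grows by at most one.
  record Round (g : ℕ) (U : Fin n → Bool) (c₀ c : Colouring) : Set where
    field
      explored : Explored g U c
      attached : ∀ v → c v ≡ frontier → Attached c v
      advanced : ∀ v → c₀ v ↝ c v
  open Round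

  Stuck : ℕ → Colouring → Colouring → Set
  Stuck g c₀ c = ∀ v → c₀ v ≡ frontier → c v ≡ frontier → g < deg (isFrontier ∘ c) v

  -- Every absorption removes a vertex from the rest, so `k` bounds the number of absorptions still
  -- possible in this round.
  play-round : ∀ {g U c₀} k c → # (isRest ∘ c) ≤ k → Round g U c₀ c →
               ∃ λ c' → Round g U c₀ c' × Stuck g c₀ c'
  play-round {g} {U} {c₀} k c rest≤k ρ
    with Fin.any? (λ v → isFrontier? (c₀ v) ×-dec isFrontier? (c v) ×-dec (deg (isFrontier ∘ c) v ≤? g))
  ... | no none = c , ρ , λ v c₀v cv → ≰⇒> (λ low → none (v , c₀v , cv , low))
  play-round zero c rest≤0 ρ | yes (v , c₀v , cv , low) =
    contradiction (≤-trans (≤-trans (m≤n+m 1 _) (≤-reflexive (sym (#rest-absorb {c} cv)))) rest≤0) λ ()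
  play-round {g} {U} {c₀} (suc k) c rest≤k ρ | yes (v , c₀v , cv , low) =
    play-round k (absorb v c)
      (s≤s⁻¹ (≤-trans (≤-reflexive (trans (+-comm 1 _) (sym (#rest-absorb {c} cv)))) rest≤k))
      record
        { explored = explored-absorb cv low (ρ .explored)
        ; attached = attached-absorb {c} cv (λ w _ → ρ .attached w)
        ; advanced = absorb-↝ {c₀} {c} {v} c₀v (ρ .advanced)
        }

  -- Small connected sets joining core vertices to the root.

  Tendril : Colouring → Fin n → ℕ → Fin n → Set
  Tendril c r s x = ∃ λ P →
    Rooted r P × P x ≡ true × (∀ w → P w ≡ true → c w ≡ core) × # P ≤ s

  -- Tendrils are vertex sets rather than paths, so the union is formed directly. It starts from the
  -- root alone, whence the summand 1, which also covers `k = 0`.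
  gather : ∀ {c r s} k (x : Fin k → Fin n) → c r ≡ core → (∀ i → Tendril c r s (x i)) →
           ∃ λ P → Rooted r P × (∀ i → P (x i) ≡ true) × (∀ w → P w ≡ true → c w ≡ core) × # P ≤ 1 + k * s
  gather {c} {r} zero x cr _ =
    _ , rooted-point r , (λ ()) , (λ w r≡w → subst (λ y → c y ≡ core) (≟-true r≡w) cr) , ≤-reflexive (#-point r)
  gather {c} {r} {s} (suc k) x cr tendrils
    with tendrils zero | gather k (x ∘ suc) cr (tendrils ∘ suc)
  ... | Q , rootedQ , Qx , Q⊆core , #Q | P , rootedP , Px , P⊆core , #P =
    (λ w → Q w ∨ P w) , rooted-∨ rootedQ rootedP , contains , in-core , size
    where
    contains : ∀ i → Q (x i) ∨ P (x i) ≡ true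
    contains zero = ∨-introˡ (P (x zero)) Qx
    contains (suc i) = ∨-introʳ (Q (x (suc i))) (Px i)

    in-core : ∀ w → Q w ∨ P w ≡ true → c w ≡ core
    in-core w eq with ∨-elim (Q w) eq
    ... | inj₁ Qw = Q⊆core w Qw
    ... | inj₂ Pw = P⊆core w Pw

    size : # (λ w → Q w ∨ P w) ≤ 1 + (s + k * s)
    size = begin
      # (λ w → Q w ∨ P w)  ≤⟨ #-∨ Q P ⟩
      # Q + # P            ≤⟨ +-mono-≤ #Q #P ⟩
      s + (1 + k * s)      ≡⟨ +-suc s (k * s) ⟩
      1 + (s + k * s)      ∎
      where open ≤-Reasoning

  -- A newly absorbed vertex was in the frontier at the start of the round, hence adjacent to the
  -- core of that time. Adding it to the tendril of such a neighbour costs one vertex.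
  tendrils-round : ∀ {g U c₀ c r s} → Round g U c₀ c →
                   (∀ v → c₀ v ≡ frontier → Attached c₀ v) →
                   (∀ x → c₀ x ≡ core → Tendril c₀ r s x) →
                   ∀ x → c x ≡ core → Tendril c r (suc s) x
  tendrils-round {c = c} ρ att tendrils x cx with ↝-core (ρ .advanced x) cx
  ... | inj₁ c₀x with tendrils x c₀x
  ...   | P , rooted , Px , P⊆core , #P =
    P , rooted , Px , (λ w Pw → core-↝ (ρ .advanced w) (P⊆core w Pw)) , m≤n⇒m≤1+n #P
  tendrils-round {c = c} {s = s} ρ att tendrils x cx | inj₂ c₀x with att x c₀x
  ... | y , c₀y , yx with tendrils y c₀y
  ...   | P , rooted , Py , P⊆core , #P =
    _ , rooted-extend rooted Py yx , ∨-introˡ (P x) (≟-refl x) , in-core , size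
    where
    in-core : ∀ w → does (x Fin.≟ w) ∨ P w ≡ true → c w ≡ core
    in-core w eq with ∨-elim (does (x Fin.≟ w)) eq
    ... | inj₁ x≡w = subst (λ z → c z ≡ core) (≟-true x≡w) cx
    ... | inj₂ Pw = core-↝ (ρ .advanced w) (P⊆core w Pw)

    size : # (λ w → does (x Fin.≟ w) ∨ P w) ≤ suc s
    size = ≤-trans (#-∨ (λ w → does (x Fin.≟ w)) P) (+-mono-≤ (≤-reflexive (#-point x)) #P)

  -- Counting at the end of a round.

  #seen : ∀ (c : Colouring) → # (isSeen ∘ c) ≡ # (isCore ∘ c) + # (isFrontier ∘ c)
  #seen c = trans (sumV-cong {g = λ v → ⟦ isCore (c v) ⟧ + ⟦ isFrontier (c v) ⟧} (seen-split ∘ c))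
                  (sumV-+ (⟦_⟧ ∘ isCore ∘ c) (⟦_⟧ ∘ isFrontier ∘ c))

  #inside : ∀ {g U c} → Explored g U c → # U ≡ # (isCore ∘ c) + # (isRest ∘ c)
  #inside {U = U} {c} ex = trans
    (sumV-cong {g = λ v → ⟦ isCore (c v) ⟧ + ⟦ isRest (c v) ⟧}
      (λ v → trans (cong ⟦_⟧ (sym (ex .inside v))) (inside-split (c v))))
    (sumV-+ (⟦_⟧ ∘ isCore ∘ c) (⟦_⟧ ∘ isRest ∘ c))

  -- The stuck part of the old frontier has degree > g in a frontier of average degree ≤ g,
  -- hence a positive proportion of the frontier is newly discovered.
  seen-grows : ∀ {g U c₀ c} → Round g U c₀ c → Stuck g c₀ c →
               E (isFrontier ∘ c) ≤ g * # (isFrontier ∘ c) → # (isCore ∘ c) ≤ # (isFrontier ∘ c) →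
               suc (2 * suc g) * # (isSeen ∘ c₀) ≤ 2 * suc g * # (isSeen ∘ c)
  seen-grows {g} {U} {c₀} {c} ρ stuck sparse X≤F = begin
    -- The new vertices satisfy `D ≤ q * A`, and `D₀ ≤ D`; this turns the additive gain `A` into a
    -- factor 1 + 1/q.
    D₀ + q * D₀       ≤⟨ +-monoˡ-≤ (q * D₀) (≤-trans (≤-trans (m≤m+n D₀ A) D₀+A≤D) D≤q*A) ⟩
    q * A + q * D₀    ≡⟨ *-distribˡ-+ q A D₀ ⟨
    q * (A + D₀)      ≡⟨ cong (q *_) (+-comm A D₀) ⟩
    q * (D₀ + A)      ≤⟨ *-monoʳ-≤ q D₀+A≤D ⟩
    q * D             ∎
    where
    open ≤-Reasoning
    q = 2 * suc g
    D₀ = # (isSeen ∘ c₀)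
    D = # (isSeen ∘ c)
    F = # (isFrontier ∘ c)
    S = # (λ v → remained (c₀ v) (c v))
    A = # (λ v → appeared (c₀ v) (c v))

    F≡S+A : F ≡ S + A
    F≡S+A = trans
      (sumV-cong {g = λ v → ⟦ remained (c₀ v) (c v) ⟧ + ⟦ appeared (c₀ v) (c v) ⟧}
        (λ v → frontier-split (ρ .advanced v)))
      (sumV-+ (λ v → ⟦ remained (c₀ v) (c v) ⟧) (λ v → ⟦ appeared (c₀ v) (c v) ⟧))

    D₀+A≤D : D₀ + A ≤ D
    D₀+A≤D = ≤-trans
      (≤-reflexive (sym (sumV-+ (⟦_⟧ ∘ isSeen ∘ c₀) (λ v → ⟦ appeared (c₀ v) (c v) ⟧))))
      (sumV-mono (λ v → seen-↝ (ρ .advanced v)))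

    stuck-degree : ∀ v → suc g * ⟦ remained (c₀ v) (c v) ⟧ ≤ ⟦ isFrontier (c v) ⟧ * deg (isFrontier ∘ c) v
    stuck-degree v with c₀ v in c₀v | c v in cv
    ... | frontier | frontier = begin
      suc g * 1                     ≡⟨ *-comm (suc g) 1 ⟩
      1 * suc g                     ≤⟨ *-monoʳ-≤ 1 (stuck v c₀v cv) ⟩
      1 * deg (isFrontier ∘ c) v    ∎
    ... | frontier | outside rewrite *-zeroʳ g = z≤n
    ... | frontier | core rewrite *-zeroʳ g = z≤n
    ... | frontier | unseen rewrite *-zeroʳ g = z≤n
    ... | outside | _ rewrite *-zeroʳ g = z≤n
    ... | core | _ rewrite *-zeroʳ g = z≤n
    ... | unseen | _ rewrite *-zeroʳ g = z≤n

    [1+g]S≤gF : suc g * S ≤ g * F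
    [1+g]S≤gF = begin
      suc g * S                                         ≡⟨ sumV-* (suc g) (λ v → ⟦ remained (c₀ v) (c v) ⟧) ⟨
      sumV (λ v → suc g * ⟦ remained (c₀ v) (c v) ⟧)    ≤⟨ sumV-mono stuck-degree ⟩
      E (isFrontier ∘ c)                                ≤⟨ sparse ⟩
      g * F                                             ∎

    F≤[1+g]A : F ≤ suc g * A
    F≤[1+g]A = +-cancelʳ-≤ (g * F) F (suc g * A) (begin
      F + g * F                 ≡⟨ cong (suc g *_) F≡S+A ⟩
      suc g * (S + A)           ≡⟨ *-distribˡ-+ (suc g) S A ⟩
      suc g * S + suc g * A     ≤⟨ +-monoˡ-≤ (suc g * A) [1+g]S≤gF ⟩
      g * F + suc g * A         ≡⟨ +-comm (g * F) _ ⟩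
      suc g * A + g * F         ∎)

    D≤q*A : D ≤ q * A
    D≤q*A = begin
      D                         ≡⟨ #seen c ⟩
      # (isCore ∘ c) + F        ≤⟨ +-monoˡ-≤ F X≤F ⟩
      F + F                     ≡⟨ cong (λ m → F + m) (+-identityʳ F) ⟨
      2 * F                     ≤⟨ *-monoʳ-≤ 2 F≤[1+g]A ⟩
      2 * (suc g * A)           ≡⟨ *-assoc 2 (suc g) A ⟨
      q * A                     ∎

  -- By `charge`, deleting the core lowers `E` by at most `2 * (g * X + (X + F))`. For `F ≤ X` this
  -- is at most `(2 * g + 4) * X`, exactly the amount by which the required bound drops.
  rest-dense : ∀ {g U c} → Explored g U c → # (isFrontier ∘ c) ≤ # (isCore ∘ c) →
               (2 * g + 4) * # U < E U → (2 * g + 4) * # (isRest ∘ c) < E (isRest ∘ c)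
  rest-dense {g} {U} {c} ex F≤X dense = +-cancelʳ-< ((2 * g + 4) * X) _ _ (begin-strict
    (2 * g + 4) * Z + (2 * g + 4) * X            ≡⟨ *-distribˡ-+ (2 * g + 4) Z X ⟨
    (2 * g + 4) * (Z + X)                        ≡⟨ cong ((2 * g + 4) *_) (trans (+-comm Z X) (sym (#inside ex))) ⟩
    (2 * g + 4) * # U                            <⟨ dense ⟩
    E U                                          ≤⟨ ex .charge ⟩
    E (isRest ∘ c) + 2 * (g * X + # (isSeen ∘ c))
      ≡⟨ cong (λ d → E (isRest ∘ c) + 2 * (g * X + d)) (#seen c) ⟩
    E (isRest ∘ c) + 2 * (g * X + (X + F))
      ≤⟨ +-monoʳ-≤ (E (isRest ∘ c)) (*-monoʳ-≤ 2 (+-monoʳ-≤ (g * X) (+-monoʳ-≤ X F≤X))) ⟩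
    E (isRest ∘ c) + 2 * (g * X + (X + X))       ≡⟨ regroup (E (isRest ∘ c)) g X ⟩
    E (isRest ∘ c) + (2 * g + 4) * X             ∎)
    where
    open ≤-Reasoning
    X = # (isCore ∘ c)
    Z = # (isRest ∘ c)
    F = # (isFrontier ∘ c)

    regroup : ∀ e g x → e + 2 * (g * x + (x + x)) ≡ e + (2 * g + 4) * x
    regroup = solve-∀

  #-positive : ∀ {P : Fin n → Bool} {v} → P v ≡ true → 1 ≤ # P
  #-positive {P} {v} Pv = ≤-trans (≤-reflexive (sym (#-point v))) (sumV-mono bound)
    where
    bound : ∀ w → ⟦ does (v Fin.≟ w) ⟧ ≤ ⟦ P w ⟧
    bound w with v Fin.≟ w
    ... | yes refl rewrite Pv = ≤-refl
    ... | no _ = z≤n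

  modelIn-mono : ∀ {U U' t s s'} → (∀ v → U v ≡ true → U' v ≡ true) → s ≤ s' →
                 ModelIn U t s → ModelIn U' t s'
  modelIn-mono U⊆U' s≤s' (M , M≤s , M⊆U) = M , ≤-trans M≤s s≤s' , λ v i bv → U⊆U' v (M⊆U v i bv)

  -- The exploration and the induction on the number of branch sets.

  Reduction : (d : ℕ) (U : Fin n → Bool) → Set
  Reduction d U = ∃ λ U' → # U' < # U × (∀ v → U' v ≡ true → U v ≡ true) × d * # U' < E U'

  module _ (L : ℕ) (1≤L : 1 ≤ L) (n<2^L : n < 2 ^ L) where

    module _ {g t s : ℕ} (smaller : ∀ W → g * # W < E W → ModelIn W t s)
             {U : Fin n → Bool} (dense : (2 * g + 4) * # U < E U) (r : Fin n) where

      private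
        q = 2 * suc g

      -- The dense frontier contains a model by induction. Each of its branch sets has a vertex with
      -- a neighbour in the core; the tendrils of these neighbours together form a connected set in
      -- the core, disjoint from the frontier.
      attach-core : ∀ {c d} → Explored g U c → (∀ v → c v ≡ frontier → Attached c v) →
                    (∀ x → c x ≡ core → Tendril c r d x) → c r ≡ core → d ≤ suc q * L →
                    g * # (isFrontier ∘ c) < E (isFrontier ∘ c) →
                    ModelIn U (suc t) (s + (1 + t * suc q) * L)
      attach-core {c} {d} ex att tendrils cr d≤ denseF with smaller (isFrontier ∘ c) denseF
      ... | K@(M , _ , M⊆F) with gather t (λ i → proj₁ (foot i)) cr (λ i → tendrils _ (proj₁ (proj₂ (foot i))))
        where
        isFrontier⁻ : ∀ {x} → isFrontier x ≡ true → x ≡ frontier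
        isFrontier⁻ {frontier} _ = refl

        foot : ∀ i → Attached c (proj₁ (M .nonempty i))
        foot i = att _ (isFrontier⁻ (M⊆F _ i (proj₂ (M .nonempty i))))
      ... | P , rooted , Pfoot , P⊆core , #P =
        modelIn-mono (λ _ Uv → Uv) size (attach P K rooted disjoint P⊆U F⊆U
          (λ i → _ , proj₁ (M .nonempty i) , Pfoot i , proj₂ (M .nonempty i) , proj₂ (proj₂ (att _ _))))
        where
        disjoint : ∀ v → P v ≡ true → isFrontier (c v) ≡ false
        disjoint v Pv rewrite P⊆core v Pv = refl

        P⊆U : ∀ v → P v ≡ true → U v ≡ true
        P⊆U v Pv = trans (sym (ex .inside v)) (cong isInside (P⊆core v Pv))

        frontier-inside : ∀ x → isFrontier x ≡ true → isInside x ≡ true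
        frontier-inside frontier _ = refl

        F⊆U : ∀ v → isFrontier (c v) ≡ true → U v ≡ true
        F⊆U v Fv = trans (sym (ex .inside v)) (frontier-inside (c v) Fv)

        size : # P + s ≤ s + (1 + t * suc q) * L
        size = begin
          # P + s                     ≤⟨ +-monoˡ-≤ s #P ⟩
          -- Since `1 ≤ L`, the single vertex of the root fits into one multiple of `L`.
          1 + t * d + s               ≤⟨ +-monoˡ-≤ s (+-mono-≤ 1≤L (*-monoʳ-≤ t d≤)) ⟩
          L + t * (suc q * L) + s     ≡⟨ regroup L t (suc q) s ⟩
          s + (1 + t * suc q) * L     ∎
          where
          open ≤-Reasoning
          regroup : ∀ l t q s → l + t * (q * l) + s ≡ s + (1 + t * q) * l
          regroup = solve-∀

      -- Here `i` rounds have been played and `k` are left of a budget of `q * L`. The last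
      -- hypothesis says that at least (1 + 1/q)^i vertices are seen; with the budget exhausted this
      -- would be at least `2 ^ L`, more than the graph has.
      explore : ∀ k i c → i + k ≡ q * L → Explored g U c → (∀ v → c v ≡ frontier → Attached c v) →
                (∀ x → c x ≡ core → Tendril c r (suc i) x) → c r ≡ core →
                suc q ^ i ≤ q ^ i * # (isSeen ∘ c) →
                ModelIn U (suc t) (s + (1 + t * suc q) * L) ⊎ Reduction (2 * g + 4) U
      explore zero i c i≡qL ex att tendrils cr growth with trans (sym (+-identityʳ i)) i≡qL
      ... | refl = contradiction contra (<-irrefl refl)
        where
        open ≤-Reasoning
        contra : suc q ^ (q * L) < suc q ^ (q * L)
        contra = begin-strict
          suc q ^ (q * L)                  ≤⟨ growth ⟩
          q ^ (q * L) * # (isSeen ∘ c)     ≤⟨ *-monoʳ-≤ (q ^ (q * L)) (#≤n (isSeen ∘ c)) ⟩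
          q ^ (q * L) * n                  <⟨ *-monoʳ-< (q ^ (q * L)) {{m^n≢0 q (q * L)}} n<2^L ⟩
          q ^ (q * L) * 2 ^ L              ≤⟨ exponential-growth q L ⟩
          suc q ^ (q * L)                  ∎
      explore (suc k) i c₀ i+k≡qL ex₀ att₀ tendrils₀ cr₀ growth₀
        with play-round {g} {U} {c₀} _ c₀ ≤-refl
               record { explored = ex₀ ; attached = att₀ ; advanced = λ _ → stay }
      ... | c , ρ , stuck
        with g * # (isFrontier ∘ c) <? E (isFrontier ∘ c) | # (isFrontier ∘ c) ≤? # (isCore ∘ c)
      ... | yes denseF | _ = inj₁ (attach-core (ρ .explored) (ρ .attached) tendrils cr depth denseF)
        where
        tendrils : ∀ x → c x ≡ core → Tendril c r (suc (suc i)) x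
        tendrils = tendrils-round ρ att₀ tendrils₀

        cr : c r ≡ core
        cr = core-↝ (ρ .advanced r) cr₀

        -- The round just played raises the tendril bound from `suc i` to `suc (suc i)`. It was
        -- within the budget, so `suc i ≤ q * L`, and the extra 1 is at most `L`.
        depth : suc (suc i) ≤ suc q * L
        depth = +-mono-≤ 1≤L (≤-trans (≤-trans (s≤s (m≤m+n i k)) (≤-reflexive (sym (+-suc i k)))) (≤-reflexive i+k≡qL))
      ... | no _ | yes F≤X = inj₂ (isRest ∘ c , fewer , rest⊆U , rest-dense (ρ .explored) F≤X dense)
        where
        -- The root lies in the core, so deleting the core makes progress.
        fewer : # (isRest ∘ c) < # U
        fewer = ≤-trans
          (+-monoˡ-≤ (# (isRest ∘ c)) (#-positive {isCore ∘ c} {r} (cong isCore (core-↝ (ρ .advanced r) cr₀))))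
          (≤-reflexive (sym (#inside (ρ .explored))))

        rest-inside : ∀ x → isRest x ≡ true → isInside x ≡ true
        rest-inside frontier _ = refl
        rest-inside unseen _ = refl

        rest⊆U : ∀ v → isRest (c v) ≡ true → U v ≡ true
        rest⊆U v Rv = trans (sym (ρ .explored .inside v)) (rest-inside (c v) Rv)
      ... | no sparse | no F≰X =
        explore k (suc i) c (trans (sym (+-suc i k)) i+k≡qL) (ρ .explored) (ρ .attached)
          (tendrils-round ρ att₀ tendrils₀) (core-↝ (ρ .advanced r) cr₀) growth
        where
        open ≤-Reasoning
        regroup : ∀ a b c → a * (b * c) ≡ b * (a * c)
        regroup = solve-∀

        growth : suc q ^ suc i ≤ q ^ suc i * # (isSeen ∘ c)
        growth = begin
          suc q * suc q ^ i                       ≤⟨ *-monoʳ-≤ (suc q) growth₀ ⟩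
          suc q * (q ^ i * # (isSeen ∘ c₀))       ≡⟨ regroup (suc q) (q ^ i) _ ⟩
          q ^ i * (suc q * # (isSeen ∘ c₀))       ≤⟨ *-monoʳ-≤ (q ^ i) (seen-grows ρ stuck (≮⇒≥ sparse) (<⇒≤ (≰⇒> F≰X))) ⟩
          q ^ i * (q * # (isSeen ∘ c))            ≡⟨ regroup (q ^ i) q _ ⟩
          q * (q ^ i * # (isSeen ∘ c))            ≡⟨ *-assoc q (q ^ i) _ ⟨
          q * q ^ i * # (isSeen ∘ c)              ∎

      -- Before the root is absorbed, the core is empty and the rest is all of `U`, so `charge`
      -- holds trivially. Absorbing the root as the only frontier vertex then yields the starting
      -- state.
      explore-from-root : U r ≡ true →
        ModelIn U (suc t) (s + (1 + t * suc q) * L) ⊎ Reduction (2 * g + 4) U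
      explore-from-root Ur = explore (q * L) 0 (absorb r c₀) refl explored₁
        (attached-absorb {c₀} c₀r (λ w w≢r c₀w → contradiction (sym (root-only w c₀w)) w≢r)) tendrils cr seen
        where
        c₀ : Colouring
        c₀ w = initial (U w) (does (r Fin.≟ w))

        c₀r : c₀ r ≡ frontier
        c₀r rewrite Ur | ≟-refl r = refl

        initial-frontier : ∀ a b → initial a b ≡ frontier → b ≡ true
        initial-frontier true true _ = refl

        root-only : ∀ w → c₀ w ≡ frontier → r ≡ w
        root-only w eq = ≟-true (initial-frontier (U w) _ eq)

        initial-inside : ∀ a b → isInside (initial a b) ≡ a
        initial-inside false _ = refl
        initial-inside true true = refl
        initial-inside true false = refl

        initial-rest : ∀ a b → isRest (initial a b) ≡ a
        initial-rest false _ = refl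
        initial-rest true true = refl
        initial-rest true false = refl

        E-initial : E (isRest ∘ c₀) ≡ E U
        E-initial = sumV-cong {f = λ u → ⟦ isRest (c₀ u) ⟧ * deg (isRest ∘ c₀) u} (λ u → cong₂ _*_
          (cong ⟦_⟧ (initial-rest (U u) _))
          (sumV-cong {f = λ w → ⟦ isRest (c₀ w) ⟧ * ⟦ adj G u w ⟧}
            (λ w → cong (λ b → ⟦ b ⟧ * ⟦ adj G u w ⟧) (initial-rest (U w) _))))

        initial-frontier-≤ : ∀ a b → ⟦ isFrontier (initial a b) ⟧ ≤ ⟦ b ⟧
        initial-frontier-≤ false _ = z≤n
        initial-frontier-≤ true true = ≤-refl
        initial-frontier-≤ true false = ≤-refl

        -- The only possible frontier vertex is the root, which is not adjacent to itself.
        low : deg (isFrontier ∘ c₀) r ≤ g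
        low = begin
          deg (isFrontier ∘ c₀) r
            ≤⟨ sumV-mono (λ w → *-monoˡ-≤ ⟦ adj G r w ⟧ (initial-frontier-≤ (U w) _)) ⟩
          sumV (λ w → ⟦ does (r Fin.≟ w) ⟧ * ⟦ adj G r w ⟧)
            ≡⟨ sumV-point r (λ w → ⟦ adj G r w ⟧) ⟩
          ⟦ adj G r r ⟧
            ≡⟨ cong ⟦_⟧ (Graph.irrefl G r) ⟩
          0
            ≤⟨ z≤n ⟩
          g ∎
          where open ≤-Reasoning

        explored₁ : Explored g U (absorb r c₀)
        explored₁ = explored-absorb {c = c₀} c₀r low record
          { inside = λ v → initial-inside (U v) _
          ; charge = ≤-trans (≤-reflexive (sym E-initial)) (m≤m+n _ _)
          }

        cr : absorb r c₀ r ≡ core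
        cr rewrite ≟-refl r = refl

        only-root : ∀ w → absorb r c₀ w ≡ core → does (r Fin.≟ w) ≡ true
        only-root w eq with does (r Fin.≟ w) | adj G r w | U w
        ... | true | _ | _ = refl
        only-root w () | false | true | false
        only-root w () | false | true | true
        only-root w () | false | false | false
        only-root w () | false | false | true

        tendrils : ∀ x → absorb r c₀ x ≡ core → Tendril (absorb r c₀) r 1 x
        tendrils x eq = _ , rooted-point r , only-root x eq ,
          (λ w r≡w → subst (λ y → absorb r c₀ y ≡ core) (≟-true r≡w) cr) , ≤-reflexive (#-point r)

        seen : 1 ≤ 1 * # (isSeen ∘ absorb r c₀)
        seen = ≤-trans (#-positive {isSeen ∘ absorb r c₀} {r} (cong isSeen cr)) (≤-reflexive (sym (*-identityˡ _)))

    -- A dense set spans an edge and so offers a root. Restarting after each reduction ends because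
    -- the order, bounded by `m`, strictly decreases.
    model-step : ∀ {g t s} → (∀ W → g * # W < E W → ModelIn W t s) →
                 ∀ m U → # U ≤ m → (2 * g + 4) * # U < E U →
                 ModelIn U (suc t) (s + (1 + t * suc (2 * suc g)) * L)
    model-step {g} smaller m U #U≤m dense
      with sumV-positive (λ u → ⟦ U u ⟧ * deg U u) (≤-<-trans z≤n dense)
    ... | r , 0<Er with explore-from-root {g} smaller dense r (proj₁ (⟦⟧-positive (U r) 0<Er))
    ...   | inj₁ K = K
    model-step smaller zero U #U≤0 dense | _ | inj₂ (_ , fewer , _) = contradiction (≤-trans fewer #U≤0) λ ()
    model-step {g} smaller (suc m) U #U≤m dense | _ | inj₂ (U' , fewer , U'⊆U , dense') =
      modelIn-mono U'⊆U ≤-refl (model-step {g} smaller m U' (s≤s⁻¹ (≤-trans fewer #U≤m)) dense')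

    small-model : ∀ t U → threshold t * # U < E U → ModelIn U (2 + t) (cost t * L)
    small-model zero U dense = modelIn-mono (λ _ Uv → Uv) (*-monoʳ-≤ 2 1≤L) (edge-model U dense)
    small-model (suc t) U dense =
      modelIn-mono (λ _ Uv → Uv) (≤-reflexive (sym (*-distribʳ-+ L (cost t) _)))
        (model-step {threshold t} (small-model t) (# U) U ≤-refl dense)

-- Binary logarithms and the passage from average degree.

module _ where
  open import Data.Nat using (_+_)

  threshold+4 : ∀ t → threshold t + 4 ≡ 2 ^ (2 + t)
  threshold+4 zero = refl
  threshold+4 (suc t) = trans (regroup (threshold t)) (cong (2 *_) (threshold+4 t))
    where
    regroup : ∀ x → 2 * x + 4 + 4 ≡ 2 * (x + 4)
    regroup = solve-∀

  -- `L` is the number of binary digits of `n`. The lower bound on `2 ^ L` limits the number of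
  -- rounds; the upper bound turns a size linear in `L` into a logarithmic one.
  ∃-binary-length : ∀ n .{{_ : NonZero n}} → ∃ λ L → 1 ≤ L × n < 2 ^ L × 2 ^ L ≤ 2 * n
  ∃-binary-length 1 = 1 , ≤-refl , ≤-refl , ≤-refl
  ∃-binary-length (suc n@(suc _)) with ∃-binary-length n
  ... | L , 1≤L , n<2^L , 2^L≤2n with suc n <? 2 ^ L
  ...   | yes 1+n<2^L = L , 1≤L , 1+n<2^L , ≤-trans 2^L≤2n (*-monoʳ-≤ 2 (n≤1+n n))
  ...   | no 1+n≮2^L = suc L , s≤s z≤n
                     , <-≤-trans (m<m*n (suc n) 2 (s≤s (s≤s z≤n))) (≤-trans (≤-reflexive (*-comm (suc n) 2)) (*-monoʳ-≤ 2 n<2^L))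
                     , *-monoʳ-≤ 2 (≮⇒≥ 1+n≮2^L)

  twiceEdges-order-1 : (G : Graph 1) → twiceEdges G ≡ 0
  twiceEdges-order-1 G rewrite Graph.irrefl G zero = refl

  -- Order 1 must be excluded, because the estimate `2 ^ L ≤ n ^ 2` fails there.
  2≤order : ∀ {n} .{{_ : NonZero n}} (G : Graph n) → 0 < twiceEdges G → 2 ≤ n
  2≤order {1} G 0<e = contradiction (subst (0 <_) (twiceEdges-order-1 G) 0<e) λ ()
  2≤order {suc (suc n)} G _ = s≤s (s≤s z≤n)

  -- The logarithmic bound is stated in exponentiated form. It follows from `2 ^ L ≤ 2 * n ≤ n ^ 2`,
  -- which accounts for the factor 2 in the exponent.
  logarithmic-model : ∀ t {n} .{{_ : NonZero n}} (G : Graph n) → 2 ^ (2 + t) * n ≤ twiceEdges G →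
                      Σ (KModel G (2 + t)) λ M → 2 ^ modelSize M ≤ n ^ (2 * cost t)
  logarithmic-model t {n} G dense with ∃-binary-length n
  ... | L , 1≤L , n<2^L , 2^L≤2n
    with small-model G L 1≤L n<2^L t (const true) dense'
    where
    open ≤-Reasoning
    dense' : threshold t * # {n} (const true) < E G (const true)
    dense' = begin-strict
      threshold t * # {n} (const true)    ≡⟨ cong (threshold t *_) (sumV-one {n}) ⟩
      -- The difference of 4 between `threshold t` and `2 ^ (2 + t)` makes the inequality strict.
      threshold t * n                     <⟨ *-monoˡ-< n (≤-trans (s≤s (m≤m+n _ 3)) (≤-reflexive (trans (sym (+-suc _ 3)) (threshold+4 t)))) ⟩
      2 ^ (2 + t) * n                     ≤⟨ dense ⟩
      twiceEdges G                        ≡⟨ sumV-cong {f = degree G} (λ u → sym (trans (*-identityˡ _)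
                                               (sumV-cong {f = λ w → 1 * ⟦ adj G u w ⟧} (λ w → *-identityˡ _)))) ⟩
      E G (const true)                    ∎
  ... | M , M≤ , _ = M , (begin
      2 ^ modelSize M      ≤⟨ ^-monoʳ-≤ 2 M≤ ⟩
      2 ^ (cost t * L)     ≡⟨ trans (cong (2 ^_) (*-comm (cost t) L)) (sym (^-*-assoc 2 L (cost t))) ⟩
      (2 ^ L) ^ cost t     ≤⟨ ^-monoˡ-≤ (cost t) (≤-trans 2^L≤2n (≤-trans (*-monoˡ-≤ n 2≤n) (≤-reflexive (cong (n *_) (sym (*-identityʳ n)))))) ⟩
      (n ^ 2) ^ cost t     ≡⟨ ^-*-assoc n 2 (cost t) ⟩
      n ^ (2 * cost t)     ∎)
    where
    open ≤-Reasoning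
    2≤n : 2 ≤ n
    2≤n = 2≤order G (≤-trans (*-mono-≤ (m^n>0 2 (2 + t)) (>-nonZero⁻¹ n)) dense)

open import Data.Integer using (+_)
open import Data.Rational using (ℚ; Positive; _/_; _+_)

-- Rationals are kept in lowest terms, so the comparison is moved to unnormalised fractions, whose
-- order is cross-multiplication.
/-≤⇒*-≤ : ∀ a b n .{{_ : NonZero n}} → Data.Rational._≤_ ((+ a) / 1) ((+ b) / n) → a * n ≤ b
/-≤⇒*-≤ a b (suc m) a≤b/n
  with ℚᵘ.≤-respʳ-≃ (ℚ.toℚᵘ-fromℚᵘ (ℚᵘ.mkℚᵘ (+ b) m))
         (ℚᵘ.≤-respˡ-≃ (ℚ.toℚᵘ-fromℚᵘ (ℚᵘ.mkℚᵘ (+ a) 0)) (ℚ.toℚᵘ-mono-≤ a≤b/n))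
... | ℚᵘ.*≤* a*n≤b*1 = subst (a * suc m ≤_) (*-identityʳ b)
        (ℤ.drop‿+≤+ (subst₂ ℤ._≤_ (sym (ℤ.pos-* a (suc m))) (sym (ℤ.pos-* b 1)) a*n≤b*1))

theorem4p1 : Σ (ℕ → ℚ → ℕ) λ h →
    (t : ℕ) (ε : ℚ) → 2 ≤ t → Positive ε →
    (n : ℕ) .{{_ : NonZero n}} (G : Graph n) →
    Data.Rational._≤_ ((+ (2 ^ t)) / 1 + ε) (averageDegree G) →
    Σ (KModel G t) λ M → 2 ^ modelSize M ≤ n ^ h t ε
theorem4p1 = (λ t _ → 2 * cost (t ∸ 2)) , proof
  where
  proof : (t : ℕ) (ε : ℚ) → 2 ≤ t → Positive ε →
    (n : ℕ) .{{_ : NonZero n}} (G : Graph n) →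
    Data.Rational._≤_ ((+ (2 ^ t)) / 1 + ε) (averageDegree G) →
    Σ (KModel G t) λ M → 2 ^ modelSize M ≤ n ^ (2 * cost (t ∸ 2))
  -- `threshold` and `cost` are indexed from two branch sets on, hence the shift by 2.
  proof (suc (suc t)) ε (s≤s (s≤s z≤n)) ε>0 n G dense =
    logarithmic-model t G (/-≤⇒*-≤ (2 ^ (2 Data.Nat.+ t)) (twiceEdges G) n (ℚ.≤-trans p≤p+ε dense))
    where
    p = (+ (2 ^ (2 Data.Nat.+ t))) / 1
    p≤p+ε : Data.Rational._≤_ p (p + ε)
    p≤p+ε = subst (λ x → Data.Rational._≤_ x (p + ε)) (ℚ.+-identityʳ p)
      (ℚ.+-monoʳ-≤ p (ℚ.<⇒≤ (ℚ.positive⁻¹ ε {{ε>0}})))
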